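{- Let $A=\{a_1,\ldots,a_k\}$ be a set of $k$ distinct positive integers with $a_1<a_2<\cdots<a_k$. If a tree $T$ has order at most $$\left(\sum_{i=1}^k a_i\right)+a_k-1+\left\lfloor\frac{k^2-3k+2}{6}\right\rfloor,$$ then $T$ is $A$-burnable.
   Context: For a vertex $u$ of a graph and an integer $m\ge 0$, $N_m[u]$ denotes the set of vertices at distance at most $m$ from $u$. For a set $A$ of positive integers $a_1,\ldots,a_k$, a graph $G$ is called $A$-burnable if there exist $k$ vertices $v_1,\ldots,v_k$ of $G$ (not necessarily distinct) such that $V(G)\subseteq\bigcup_{i=1}^k N_{a_i-1}[v_i]$. The order of a graph is its number of vertices. -}

module Defs where

open import Data.Nat using (ℕ; suc; _+_; _*_; _∸_; _/_; _≤_; NonZero)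
open import Data.Nat.Properties using (+-0-commutativeMonoid)
open import Data.Fin using (Fin; fromℕ)
open import Data.List using (List; []; _∷_)
open import Data.List.Relation.Unary.Unique.Propositional using (Unique)
open import Data.Product using (Σ-syntax; ∃-syntax; _×_)
open import Level using (0ℓ)
open import Relation.Binary using (Rel; Symmetric; Irreflexive; Decidable)
open import Relation.Binary.PropositionalEquality using (_≡_)
open import Relation.Nullary using (¬_)
open import Algebra.Properties.CommutativeMonoid.Sum +-0-commutativeMonoid using (sum)

-- Finite simple graphs of order n, with vertex set Fin n.  Decidability of
-- adjacency is automatic classically.
record Graph (n : ℕ) : Set₁ where
  field
    Adj    : Rel (Fin n) 0ℓ
    adj?   : Decidable Adj
    sym    : Symmetric Adj
    irrefl : Irreflexive _≡_ Adj

module _ {n : ℕ} (G : Graph n) where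
  open Graph G

  data Walk : Fin n → Fin n → Set where
    nil  : ∀ {u} → Walk u u
    cons : ∀ {u v w} → Adj u v → Walk v w → Walk u w

  length : ∀ {u v} → Walk u v → ℕ
  length nil        = 0
  length (cons _ p) = suc (length p)

  -- All vertices visited by the walk except its final one, so that a closed
  -- walk lists its base point only once.
  initVertices : ∀ {u v} → Walk u v → List (Fin n)
  initVertices nil                = []
  initVertices (cons {u = u} _ p) = u ∷ initVertices p

  IsCycle : ∀ {u} → Walk u u → Set
  IsCycle p = 3 ≤ length p × Unique (initVertices p)

  Connected : Set
  Connected = ∀ u v → Walk u v

  Acyclic : Set
  Acyclic = ∀ {u} (p : Walk u u) → ¬ IsCycle p

  record IsTree : Set where
    field
      nonempty  : NonZero n
      connected : Connected
      acyclic   : Acyclic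

  IsDistance : Fin n → Fin n → ℕ → Set
  IsDistance u v d = (∃[ p ] length {u} {v} p ≡ d) × (∀ (p : Walk u v) → d ≤ length p)

  -- InBall m u v means v ∈ N_m[u].
  InBall : ℕ → Fin n → Fin n → Set
  InBall m u v = ∃[ d ] IsDistance u v d × d ≤ m

  -- The set {a_1, …, a_k} is given by an enumeration; its elements are meant
  -- to be positive, so a i ∸ 1 is not truncated.
  Burnable : ∀ {k} → (Fin k → ℕ) → Set
  Burnable {k} a = Σ[ v ∈ (Fin k → Fin n) ] ∀ w → ∃[ i ] InBall (a i ∸ 1) (v i) w

-- The bound for k = suc j integers, the largest being a (fromℕ j).  Neither
-- subtraction truncates when the a i are positive: 3k ≤ k² + 2 for every
-- natural number k.
orderBound : ∀ j → (Fin (suc j) → ℕ) → ℕ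
orderBound j a = (sum a + a (fromℕ j) ∸ 1) + (k * k + 2 ∸ 3 * k) / 6
  where k = suc j

{-# OPTIONS --safe #-}

-- Root a spanning tree and keep the largest ball for the end, where it covers
-- any tree with at most 2 a_k − 1 vertices.  While K other balls of radii
-- ρ_1 < ⋯ < ρ_K remain, put g = ⌊K/3⌋ and cut off, along a deepest branch, the
-- subtree U of height exactly ρ_K.  If U has at least ρ_K + 1 + g vertices, cover
-- it from its root by the ball of radius ρ_K.  Otherwise U is a path with fewer
-- than g further vertices.  For i = K − g we have ρ_i + g ≤ ρ_K and
-- 2g ≤ ρ_i + 1, so the subtree of U of height ρ_i + g has at least
-- ρ_i + 1 + g and at most 2ρ_i + 1 vertices, hence is covered by the ball of
-- radius ρ_i.  Either way g vertices are gained over the size ρ + 1 of the ball,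
-- and the sum of ⌊m/3⌋ over m < k is ⌊(k − 1)(k − 2)/6⌋.

module Submission where

open import Data.Nat using (ℕ; zero; suc; _+_; _*_; _∸_; _/_; _⊔_; _≤_; _<_; z≤n; s≤s; s≤s⁻¹; >-nonZero; >-nonZero⁻¹)
open import Data.Nat.Properties
open import Data.Nat.DivMod using (m<n*o⇒m/o<n)
open import Data.Nat.Tactic.RingSolver using (solve-∀)
open import Data.Fin using (Fin; zero; suc; toℕ; fromℕ; fromℕ<; punchIn) renaming (_<_ to _<ᶠ_)
open import Data.Fin.Properties using (any?; toℕ-fromℕ; toℕ-fromℕ<; ≤fromℕ; punchIn-cancel-≤) renaming (_≟_ to _≟ᶠ_)
open import Data.List using (List; []; _∷_; allFin) renaming (length to lengthᴸ)
open import Data.List.Membership.Propositional using (_∈_)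
open import Data.List.Membership.Propositional.Properties using (∈-allFin)
open import Data.List.Properties using (length-removeAt′; length-tabulate)
open import Data.List.Relation.Unary.Any using (here; there; index; _─_)
open import Data.Vec.Functional using (insertAt; removeAt)
open import Data.Vec.Functional.Properties using (insertAt-lookup; insertAt-punchIn)
open import Data.Product using (∃-syntax; ∃₂; _×_; _,_)
open import Data.Sum using (_⊎_; inj₁; inj₂; [_,_]′)
open import Function using (_∘_; id)
open import Relation.Binary.PropositionalEquality using (_≡_; refl; sym; trans; cong; subst; subst₂)
open import Relation.Nullary using (Dec; yes; no; contradiction)
open import Relation.Nullary.Decidable using (map′; _×-dec_)
open import Algebra.Properties.CommutativeMonoid.Sum +-0-commutativeMonoid using (sum; sum-remove; sum-cong-≗)
open import Defs

⌊_/3⌋ : ℕ → ℕ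
⌊ suc (suc (suc m)) /3⌋ = suc ⌊ m /3⌋
⌊ _                 /3⌋ = 0

3*⌊m/3⌋≤m : ∀ m → ⌊ m /3⌋ + (⌊ m /3⌋ + ⌊ m /3⌋) ≤ m
3*⌊m/3⌋≤m 0 = z≤n
3*⌊m/3⌋≤m 1 = z≤n
3*⌊m/3⌋≤m 2 = z≤n
3*⌊m/3⌋≤m (suc (suc (suc m))) = begin
  suc q + (suc q + suc q)  ≡⟨ identity q ⟩
  3 + (q + (q + q))        ≤⟨ +-monoʳ-≤ 3 (3*⌊m/3⌋≤m m) ⟩
  3 + m                    ∎
  where
  open ≤-Reasoning
  q = ⌊ m /3⌋
  identity : ∀ q → suc q + (suc q + suc q) ≡ 3 + (q + (q + q))
  identity = solve-∀

⌊m/3⌋-hermite : ∀ m → ⌊ 2 + m /3⌋ + (⌊ 1 + m /3⌋ + ⌊ m /3⌋) ≡ m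
⌊m/3⌋-hermite 0 = refl
⌊m/3⌋-hermite 1 = refl
⌊m/3⌋-hermite 2 = refl
⌊m/3⌋-hermite (suc (suc (suc m))) =
  trans (identity ⌊ 2 + m /3⌋ ⌊ 1 + m /3⌋ ⌊ m /3⌋) (cong (3 +_) (⌊m/3⌋-hermite m))
  where
  identity : ∀ p q r → suc p + (suc q + suc r) ≡ 3 + (p + (q + r))
  identity = solve-∀

gain : ℕ → ℕ
gain zero    = 0
gain (suc m) = ⌊ suc m /3⌋ + gain m

gain-lower : ∀ m → m * m ≤ gain m * 6 + m + 2
gain-lower 0 = z≤n
gain-lower 1 = s≤s z≤n
gain-lower 2 = ≤-refl
gain-lower (suc (suc (suc m))) = begin
  (3 + m) * (3 + m)                  ≡⟨ square m ⟩
  m * m + (6 * m + 9)                ≤⟨ +-monoˡ-≤ _ (gain-lower m) ⟩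
  gain m * 6 + m + 2 + (6 * m + 9)   ≡⟨ regroup (gain m) m ⟩
  (suc m + gain m) * 6 + (3 + m) + 2 ≡⟨ cong (λ x → x * 6 + (3 + m) + 2) (sym three-steps) ⟩
  gain (3 + m) * 6 + (3 + m) + 2     ∎
  where
  open ≤-Reasoning
  square : ∀ m → (3 + m) * (3 + m) ≡ m * m + (6 * m + 9)
  square = solve-∀
  regroup : ∀ x m → x * 6 + m + 2 + (6 * m + 9) ≡ (suc m + x) * 6 + (3 + m) + 2
  regroup = solve-∀
  rotate : ∀ p q r x → suc r + (p + (q + x)) ≡ suc (p + (q + r)) + x
  rotate = solve-∀
  three-steps : gain (3 + m) ≡ suc m + gain m
  three-steps = trans (rotate ⌊ 2 + m /3⌋ ⌊ 1 + m /3⌋ ⌊ m /3⌋ (gain m))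
                      (cong (λ x → suc x + gain m) (⌊m/3⌋-hermite m))

bonus≤gain : ∀ j → (suc j * suc j + 2 ∸ 3 * suc j) / 6 ≤ gain j
bonus≤gain j = s≤s⁻¹ (m<n*o⇒m/o<n (begin-strict
  suc j * suc j + 2 ∸ 3 * suc j   ≤⟨ m≤n+o⇒m∸n≤o _ (3 * suc j) enough ⟩
  gain j * 6 + 2                  <⟨ +-monoʳ-< (gain j * 6) {2} {6} (s≤s (s≤s (s≤s z≤n))) ⟩
  gain j * 6 + 6                  ≡⟨ +-comm (gain j * 6) 6 ⟩
  suc (gain j) * 6                ∎))
  where
  open ≤-Reasoning
  expand : ∀ j → suc j * suc j + 2 ≡ j * j + (2 * j + 3)
  expand = solve-∀
  regroup : ∀ x j → x * 6 + j + 2 + (2 * j + 3) ≡ 3 * suc j + (x * 6 + 2)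
  regroup = solve-∀
  enough : suc j * suc j + 2 ≤ 3 * suc j + (gain j * 6 + 2)
  enough = begin
    suc j * suc j + 2                 ≡⟨ expand j ⟩
    j * j + (2 * j + 3)               ≤⟨ +-monoˡ-≤ _ (gain-lower j) ⟩
    gain j * 6 + j + 2 + (2 * j + 3)  ≡⟨ regroup (gain j) j ⟩
    3 * suc j + (gain j * 6 + 2)      ∎

StrictlyIncreasing : ∀ {m} → (Fin m → ℕ) → Set
StrictlyIncreasing ρ = ∀ {i j} → i <ᶠ j → ρ i < ρ j

total : ∀ {m} → (Fin m → ℕ) → ℕ
total ρ = sum λ i → suc (ρ i)

total-remove : ∀ {m} (ρ : Fin (suc m) → ℕ) i → total ρ ≡ suc (ρ i) + total (removeAt ρ i)
total-remove ρ i = sum-remove {i = i} λ k → suc (ρ k)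

removeAt-increasing : ∀ {m} {ρ : Fin (suc m) → ℕ} i →
                      StrictlyIncreasing ρ → StrictlyIncreasing (removeAt ρ i)
removeAt-increasing i ρ↑ {j} {k} j<k =
  ρ↑ (≰⇒> λ k≤j → <⇒≱ j<k (punchIn-cancel-≤ i k j k≤j))

increasing-gap : ∀ {m} (ρ : Fin m → ℕ) → StrictlyIncreasing ρ →
                 ∀ i j → toℕ i ≤ toℕ j → ρ i + toℕ j ≤ ρ j + toℕ i
increasing-gap ρ ρ↑ zero zero _ = ≤-refl
increasing-gap {suc (suc m)} ρ ρ↑ zero (suc j) _ = begin
  ρ zero + suc (toℕ j)        ≡⟨ +-suc (ρ zero) (toℕ j) ⟩
  suc (ρ zero) + toℕ j        ≤⟨ +-monoˡ-≤ (toℕ j) (ρ↑ (s≤s z≤n)) ⟩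
  ρ (suc zero) + toℕ j        ≤⟨ increasing-gap (ρ ∘ suc) (ρ↑ ∘ s≤s) zero j z≤n ⟩
  ρ (suc j) + 0               ∎
  where open ≤-Reasoning
increasing-gap ρ ρ↑ (suc i) (suc j) (s≤s i≤j) =
  subst₂ _≤_ (sym (+-suc (ρ (suc i)) (toℕ j))) (sym (+-suc (ρ (suc j)) (toℕ i)))
    (s≤s (increasing-gap (ρ ∘ suc) (ρ↑ ∘ s≤s) i j i≤j))

middle-radius : ∀ m (ρ : Fin (suc m) → ℕ) → StrictlyIncreasing ρ →
                ∀ g → g + (g + g) ≤ suc m →
                ∃[ i ] (ρ i + g ≤ ρ (fromℕ m)) × (g + g ≤ suc (ρ i))
middle-radius m ρ ρ↑ g 3g≤m = i , below-top , large
  where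
  open ≤-Reasoning
  bounded : ∀ g → g + (g + g) ≤ suc m → g ≤ m
  bounded zero    _   = z≤n
  bounded (suc g) 3g≤ = s≤s⁻¹ (≤-trans (≤-trans (≤-reflexive (+-comm 1 (suc g))) (+-monoʳ-≤ (suc g) (s≤s z≤n))) 3g≤)
  q = m ∸ g
  i = fromℕ< (s≤s (m∸n≤m m g))
  i≡q : toℕ i ≡ q
  i≡q = toℕ-fromℕ< (s≤s (m∸n≤m m g))
  q+g≡m : q + g ≡ m
  q+g≡m = m∸n+n≡m (bounded g 3g≤m)
  below-top : ρ i + g ≤ ρ (fromℕ m)
  below-top = +-cancelʳ-≤ q _ _ (begin
    ρ i + g + q                ≡⟨ +-assoc (ρ i) g q ⟩
    ρ i + (g + q)              ≡⟨ cong (ρ i +_) (trans (+-comm g q) q+g≡m) ⟩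
    ρ i + m                    ≡⟨ cong (ρ i +_) (sym (toℕ-fromℕ m)) ⟩
    ρ i + toℕ (fromℕ m)        ≤⟨ increasing-gap ρ ρ↑ i (fromℕ m) (≤fromℕ i) ⟩
    ρ (fromℕ m) + toℕ i        ≡⟨ cong (ρ (fromℕ m) +_) i≡q ⟩
    ρ (fromℕ m) + q            ∎)
  large : g + g ≤ suc (ρ i)
  large = +-cancelˡ-≤ g _ _ (begin
    g + (g + g)                ≤⟨ 3g≤m ⟩
    suc m                      ≡⟨ cong suc (sym (trans (+-comm g q) q+g≡m)) ⟩
    suc (g + q)                ≡⟨ sym (+-suc g q) ⟩
    g + suc q                  ≡⟨ cong (λ x → g + suc x) (sym i≡q) ⟩
    g + suc (toℕ i)            ≤⟨ +-monoʳ-≤ g (s≤s (m≤n+m (toℕ i) (ρ zero))) ⟩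
    g + suc (ρ zero + toℕ i)   ≤⟨ +-monoʳ-≤ g (s≤s (increasing-gap ρ ρ↑ zero i z≤n)) ⟩
    g + suc (ρ i + 0)          ≡⟨ cong (λ x → g + suc x) (+-identityʳ (ρ i)) ⟩
    g + suc (ρ i)              ∎)

∈-─ : ∀ {A : Set} {x y : A} {xs} (x∈xs : x ∈ xs) → y ∈ xs → y ≡ x ⊎ y ∈ (xs ─ x∈xs)
∈-─ (here refl)  (here y≡x)   = inj₁ y≡x
∈-─ (here _)     (there y∈xs) = inj₂ y∈xs
∈-─ (there _)    (here y≡z)   = inj₂ (here y≡z)
∈-─ (there x∈xs) (there y∈xs) = [ inj₁ , inj₂ ∘ there ]′ (∈-─ x∈xs y∈xs)

module _ {n : ℕ} (G : Graph n) where
  open Graph G renaming (sym to adj-sym)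

  Within : ℕ → Fin n → Fin n → Set
  Within m u v = ∃[ p ] length G {u} {v} p ≤ m

  within-refl : ∀ {u m} → Within m u u
  within-refl = nil , z≤n

  within-edge : ∀ {u v} → Adj u v → Within 1 u v
  within-edge e = cons e nil , ≤-refl

  within-mono : ∀ {m m′ u v} → m ≤ m′ → Within m u v → Within m′ u v
  within-mono m≤m′ (p , p≤m) = p , ≤-trans p≤m m≤m′

  within-trans : ∀ {m m′ u v w} → Within m u v → Within m′ v w → Within (m + m′) u w
  within-trans {m} {m′} (nil , _) q = within-mono (m≤n+m m′ m) q
  within-trans (cons e p , s≤s p≤m) q with within-trans (p , p≤m) q
  ... | r , r≤ = cons e r , s≤s r≤

  walkOfLength? : ∀ d u v → Dec (∃[ p ] length G {u} {v} p ≡ d)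
  walkOfLength? zero u v = map′ (λ { refl → nil , refl }) (λ { (nil , _) → refl }) (u ≟ᶠ v)
  walkOfLength? (suc d) u v =
    map′ (λ { (w , e , p , refl) → cons e p , refl })
         (λ { (cons e p , refl) → _ , e , p , refl })
         (any? λ w → adj? u w ×-dec walkOfLength? d w v)

  distance : ∀ {u v} (p : Walk G u v) → ∃[ d ] IsDistance G u v d
  distance {u} {v} p = search (length G p) 0 (≤-reflexive (sym (+-identityʳ _))) (λ _ → z≤n)
    where
    search : ∀ fuel d → length G p ≤ fuel + d → (∀ q → d ≤ length G q) →
             ∃[ d ] IsDistance G u v d
    search fuel d bound lower with walkOfLength? d u v
    ... | yes found = d , found , lower
    search zero d bound lower | no none = contradiction (p , ≤-antisym bound (lower p)) none
    search (suc fuel) d bound lower | no none =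
      search fuel (suc d) (subst (length G p ≤_) (sym (+-suc fuel d)) bound)
        (λ q → ≤∧≢⇒< (lower q) λ d≡q → none (q , sym d≡q))

  within⇒InBall : ∀ {m u v} → Within m u v → InBall G m u v
  within⇒InBall (p , p≤m) with distance p
  ... | d , isd@(_ , lower) = d , isd , ≤-trans (lower p) p≤m

  -- The children of p in a rooted tree, in first-child/next-sibling form: in
  -- node v e c s, c holds the children of v and s the later siblings of v.
  data Forest (p : Fin n) : Set where
    []   : Forest p
    node : ∀ v → Adj p v → Forest v → Forest p → Forest p

  size : ∀ {p} → Forest p → ℕ
  size []             = 0
  size (node _ _ c s) = suc (size c + size s)

  height : ∀ {p} → Forest p → ℕ
  height []             = 0
  height (node _ _ c s) = suc (height c) ⊔ height s

  data _∈ᶠ_ (w : Fin n) {p : Fin n} : Forest p → Set where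
    here  : ∀ {e c s}   → w ∈ᶠ node w e c s
    child : ∀ {v e c s} → w ∈ᶠ c → w ∈ᶠ node v e c s
    later : ∀ {v e c s} → w ∈ᶠ s → w ∈ᶠ node v e c s

  _∈ᵗ_ : Fin n → ∀ {p} → Forest p → Set
  _∈ᵗ_ w {p} f = w ≡ p ⊎ w ∈ᶠ f

  height≤size : ∀ {p} (f : Forest p) → height f ≤ size f
  height≤size []             = z≤n
  height≤size (node _ _ c s) = ⊔-lub
    (s≤s (≤-trans (height≤size c) (m≤m+n (size c) (size s))))
    (≤-trans (height≤size s) (m≤n+m (size s) (suc (size c))))

  within-height : ∀ {p w} (f : Forest p) → w ∈ᵗ f → Within (height f) p w
  within-height f (inj₁ refl) = within-refl
  within-height (node _ e c s) (inj₂ here) =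
    within-mono (≤-trans (s≤s z≤n) (m≤m⊔n (suc (height c)) (height s))) (within-edge e)
  within-height (node _ e c s) (inj₂ (child w∈c)) =
    within-mono (m≤m⊔n (suc (height c)) (height s))
      (within-trans (within-edge e) (within-height c (inj₂ w∈c)))
  within-height (node _ e c s) (inj₂ (later w∈s)) =
    within-mono (m≤n⊔m (suc (height c)) (height s)) (within-height s (inj₂ w∈s))

  within-size : ∀ {p w} (f : Forest p) → w ∈ᵗ f → Within (size f) p w
  within-size f w∈f = within-mono (height≤size f) (within-height f w∈f)

  -- Cut f c f′: deleting from f a vertex v together with its children c leaves f′.
  data Cut {v : Fin n} : ∀ {p} → Forest p → Forest v → Forest p → Set where
    here  : ∀ {p} {e : Adj p v} {c s} → Cut (node v e c s) c s
    child : ∀ {p u} {e : Adj p u} {c d d′ s} → Cut d c d′ → Cut (node u e d s) c (node u e d′ s)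
    later : ∀ {p u} {e : Adj p u} {c d s s′} → Cut s c s′ → Cut (node u e d s) c (node u e d s′)

  cut-size : ∀ {p v} {f f′ : Forest p} {c : Forest v} →
             Cut f c f′ → size f ≡ size f′ + suc (size c)
  cut-size (here {c = c} {s}) = trans (cong suc (+-comm (size c) (size s))) (sym (+-suc (size s) (size c)))
  cut-size (child {c = c} {d} {d′} {s} x) =
    cong suc (trans (cong (_+ size s) (cut-size x)) (swap (size d′) (suc (size c)) (size s)))
    where
    swap : ∀ a b c → a + b + c ≡ a + c + b
    swap = solve-∀
  cut-size (later {c = c} {d} {s} {s′} x) =
    cong suc (trans (cong (size d +_) (cut-size x)) (sym (+-assoc (size d) (size s′) (suc (size c)))))

  cut-∈ : ∀ {p v w} {f f′ : Forest p} {c : Forest v} →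
          Cut f c f′ → w ∈ᶠ f → w ∈ᶠ f′ ⊎ w ∈ᵗ c
  cut-∈ here      here        = inj₂ (inj₁ refl)
  cut-∈ here      (child w∈c) = inj₂ (inj₂ w∈c)
  cut-∈ here      (later w∈s) = inj₁ w∈s
  cut-∈ (child x) here        = inj₁ here
  cut-∈ (child x) (child w∈d) = [ inj₁ ∘ child , inj₂ ]′ (cut-∈ x w∈d)
  cut-∈ (child x) (later w∈s) = inj₁ (later w∈s)
  cut-∈ (later x) here        = inj₁ here
  cut-∈ (later x) (child w∈d) = inj₁ (child w∈d)
  cut-∈ (later x) (later w∈s) = [ inj₁ ∘ later , inj₂ ]′ (cut-∈ x w∈s)

  cut-∈ᵗ : ∀ {p v w} {f f′ : Forest p} {c : Forest v} →
           Cut f c f′ → w ∈ᵗ f → w ∈ᵗ f′ ⊎ w ∈ᵗ c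
  cut-∈ᵗ x (inj₁ w≡p) = inj₁ (inj₁ w≡p)
  cut-∈ᵗ x (inj₂ w∈f) = [ inj₁ ∘ inj₂ , inj₂ ]′ (cut-∈ x w∈f)

  cut-trans : ∀ {p v w} {f f′ : Forest p} {c c′ : Forest v} {d : Forest w} →
              Cut f c f′ → Cut c d c′ → ∃[ f″ ] Cut f d f″
  cut-trans here      y = _ , child y
  cut-trans (child x) y with cut-trans x y
  ... | _ , z = _ , child z
  cut-trans (later x) y with cut-trans x y
  ... | _ , z = _ , later z

  -- A path from the deleted vertex v to w needs, besides v, only remaining vertices.
  cut-within : ∀ {p v w} {f f′ : Forest p} {c : Forest v} →
               Cut f c f′ → w ∈ᵗ f′ → Within (suc (size f′)) v w
  cut-within (here {e = e} {s = s}) w∈s =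
    within-trans (within-edge (adj-sym e)) (within-size s w∈s)
  cut-within (child {e = e} {d′ = d′} {s} x) (inj₁ refl) =
    within-mono (≤-trans (≤-reflexive (+-comm (suc (size d′)) 1)) (s≤s (s≤s (m≤m+n (size d′) (size s)))))
      (within-trans (cut-within x (inj₁ refl)) (within-edge (adj-sym e)))
  cut-within (child {d′ = d′} {s} x) (inj₂ here) =
    within-mono (s≤s (m≤n⇒m≤1+n (m≤m+n (size d′) (size s)))) (cut-within x (inj₁ refl))
  cut-within (child {d′ = d′} {s} x) (inj₂ (child w∈d′)) =
    within-mono (s≤s (m≤n⇒m≤1+n (m≤m+n (size d′) (size s)))) (cut-within x (inj₂ w∈d′))
  cut-within (child {e = e} {d′ = d′} {s} x) (inj₂ (later w∈s)) =
    within-mono (≤-reflexive (cong suc (+-suc (size d′) (size s))))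
      (within-trans (cut-within x (inj₁ refl))
        (within-trans (within-edge (adj-sym e)) (within-size s (inj₂ w∈s))))
  cut-within (later {d = d} {s′ = s′} x) w∈f′ with w∈f′
  ... | inj₁ refl         = within-mono (s≤s (m≤n+m (size s′) (suc (size d)))) (cut-within x (inj₁ refl))
  ... | inj₂ (later w∈s′) = within-mono (s≤s (m≤n+m (size s′) (suc (size d)))) (cut-within x (inj₂ w∈s′))
  cut-within (later {e = e} {d = d} {s′ = s′} x) w∈f′ | inj₂ here =
    within-mono (s≤s (≤-trans (≤-reflexive (+-comm (size s′) 1)) (s≤s (m≤n+m (size s′) (size d)))))
      (within-trans (cut-within x (inj₁ refl)) (within-edge e))
  cut-within (later {e = e} {d = d} {s′ = s′} x) w∈f′ | inj₂ (child w∈d) =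
    within-mono (≤-reflexive (cong suc (+-comm (size s′) (suc (size d)))))
      (within-trans (cut-within x (inj₁ refl))
        (within-trans (within-edge e) (within-size d (inj₂ w∈d))))

  record CutAtHeight {p} (f : Forest p) (h : ℕ) : Set where
    constructor cutAt
    field
      {vertex}  : Fin n
      subtree   : Forest vertex
      {rest}    : Forest p
      cut       : Cut f subtree rest
      height≡   : height subtree ≡ h
      rest-size : height f ≤ h + suc (size rest)

  cut-at-height : ∀ {p} (f : Forest p) h → h < height f → CutAtHeight f h
  cut-at-height (node v e c s) h h<f with ≤-total (height s) (suc (height c))
  ... | inj₂ c≤s with cut-at-height s h (subst (h <_) (m≤n⇒m⊔n≡n c≤s) h<f)
  ...   | cutAt t {rest} x eq bound = cutAt t (later x) eq (begin
      suc (height c) ⊔ height s        ≡⟨ m≤n⇒m⊔n≡n c≤s ⟩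
      height s                         ≤⟨ bound ⟩
      h + suc (size rest)              ≤⟨ +-monoʳ-≤ h (s≤s (m≤n+m (size rest) (suc (size c)))) ⟩
      h + suc (suc (size c + size rest)) ∎)
    where open ≤-Reasoning
  cut-at-height (node v e c s) h h<f | inj₁ s≤c with m≤n⇒m<n∨m≡n (s≤s⁻¹ (subst (h <_) (m≥n⇒m⊔n≡m s≤c) h<f))
  ... | inj₂ refl = cutAt c here refl (begin
      suc (height c) ⊔ height s        ≡⟨ m≥n⇒m⊔n≡m s≤c ⟩
      suc (height c)                   ≡⟨ +-comm 1 (height c) ⟩
      height c + 1                     ≤⟨ +-monoʳ-≤ (height c) (s≤s z≤n) ⟩
      height c + suc (size s)          ∎)
    where open ≤-Reasoning
  ... | inj₁ h<c with cut-at-height c h h<c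
  ...   | cutAt t {rest} x eq bound = cutAt t (child x) eq (begin
      suc (height c) ⊔ height s        ≡⟨ m≥n⇒m⊔n≡m s≤c ⟩
      suc (height c)                   ≤⟨ s≤s bound ⟩
      suc (h + suc (size rest))        ≡⟨ sym (+-suc h (suc (size rest))) ⟩
      h + suc (suc (size rest))        ≤⟨ +-monoʳ-≤ h (s≤s (s≤s (m≤m+n (size rest) (size s)))) ⟩
      h + suc (suc (size rest + size s)) ∎)
    where open ≤-Reasoning

  Covers : ℕ → Fin n → ∀ {p} → Forest p → Set
  Covers ρ x f = ∀ {w} → w ∈ᵗ f → Within ρ x w

  covers-height : ∀ {ρ p} (f : Forest p) → height f ≤ ρ → Covers ρ p f
  covers-height f f≤ρ w∈f = within-mono f≤ρ (within-height f w∈f)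

  -- Centre at the vertex of height ρ on a deepest branch: its own subtree already
  -- has ρ + 1 vertices, so at most ρ remain outside.
  covers-small : ∀ {ρ p} (f : Forest p) → size f ≤ ρ + ρ → ∃[ x ] Covers ρ x f
  covers-small {ρ} {p} f small with height f ≤? ρ
  ... | yes f≤ρ = p , covers-height f f≤ρ
  ... | no f≰ρ with cut-at-height f ρ (≰⇒> f≰ρ)
  ...   | cutAt {v} t {rest} x eq _ = v , λ w∈f →
      [ within-mono rest≤ρ ∘ cut-within x , covers-height t (≤-reflexive eq) ]′ (cut-∈ᵗ x w∈f)
    where
    open ≤-Reasoning
    rest≤ρ : suc (size rest) ≤ ρ
    rest≤ρ = +-cancelʳ-≤ ρ _ _ (begin
      suc (size rest) + ρ         ≤⟨ +-monoʳ-≤ _ (subst (_≤ size t) eq (height≤size t)) ⟩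
      suc (size rest) + size t    ≡⟨ sym (+-suc (size rest) (size t)) ⟩
      size rest + suc (size t)    ≡⟨ sym (cut-size x) ⟩
      size f                      ≤⟨ small ⟩
      ρ + ρ                       ∎)

  record Saving {p m} (ρ : Fin m → ℕ) (g : ℕ) (f : Forest p) : Set where
    constructor saving
    field
      i         : Fin m
      {vertex}  : Fin n
      {subtree} : Forest vertex
      {rest}    : Forest p
      cut       : Cut f subtree rest
      gains     : ρ i + g ≤ size subtree
      centre    : Fin n
      covers    : Covers (ρ i) centre subtree

  find-saving : ∀ {p} m (ρ : Fin (suc m) → ℕ) → StrictlyIncreasing ρ →
                ∀ g → g + (g + g) ≤ suc m →
                (f : Forest p) → ρ (fromℕ m) < height f → Saving ρ g f
  find-saving m ρ ρ↑ g 3g≤ f tall with cut-at-height f (ρ (fromℕ m)) tall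
  ... | cutAt {v} t x t≡ _ with ρ (fromℕ m) + g ≤? size t
  ...   | yes big = saving (fromℕ m) x big v (covers-height t (≤-reflexive t≡))
  ...   | no notBig with middle-radius m ρ ρ↑ g 3g≤
  ...     | i , below-top , large with m≤n⇒m<n∨m≡n (subst (ρ i + g ≤_) (sym t≡) below-top)
  ...       | inj₂ eq with covers-small {ρ i} t (begin
        size t               ≤⟨ s≤s⁻¹ (≤-trans (≰⇒> notBig) (begin
          ρ (fromℕ m) + g      ≡⟨ cong (_+ g) (sym (trans eq t≡)) ⟩
          ρ i + g + g          ≡⟨ +-assoc (ρ i) g g ⟩
          ρ i + (g + g)        ≤⟨ +-monoʳ-≤ (ρ i) large ⟩
          ρ i + suc (ρ i)      ≡⟨ +-suc (ρ i) (ρ i) ⟩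
          suc (ρ i + ρ i)      ∎)) ⟩
        ρ i + ρ i            ∎)
    where open ≤-Reasoning
  ...         | c , cov = saving i x (≤-trans (≤-reflexive eq) (height≤size t)) c cov
  find-saving m ρ ρ↑ g 3g≤ f tall | cutAt {v} t x t≡ _ | no notBig | i , below-top , large | inj₁ lt
    with cut-at-height t (ρ i + g) lt
  ... | cutAt d {rest} y d≡ bound with cut-trans x y | covers-small {ρ i} d small
    where
    open ≤-Reasoning
    small : size d ≤ ρ i + ρ i
    small = s≤s⁻¹ (+-cancelʳ-≤ (size rest) _ _ (s≤s⁻¹ (begin
      suc (suc (size d) + size rest)      ≡⟨ cong suc (+-comm (suc (size d)) (size rest)) ⟩
      suc (size rest + suc (size d))      ≡⟨ cong suc (sym (cut-size y)) ⟩
      suc (size t)                        ≤⟨ ≰⇒> notBig ⟩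
      ρ (fromℕ m) + g                     ≡⟨ cong (_+ g) (sym t≡) ⟩
      height t + g                        ≤⟨ +-monoˡ-≤ g bound ⟩
      ρ i + g + suc (size rest) + g       ≡⟨ regroup (ρ i) g (size rest) ⟩
      suc (ρ i + (g + g) + size rest)     ≤⟨ s≤s (+-monoˡ-≤ (size rest) (+-monoʳ-≤ (ρ i) large)) ⟩
      suc (ρ i + suc (ρ i) + size rest)   ≡⟨ cong (λ z → suc (z + size rest)) (+-suc (ρ i) (ρ i)) ⟩
      suc (suc (ρ i + ρ i) + size rest)   ∎)))
      where
      regroup : ∀ a g r → a + g + suc r + g ≡ suc (a + (g + g) + r)
      regroup = solve-∀
  ...   | _ , z | c , cov = saving i z (subst (_≤ size d) d≡ (height≤size d)) c cov

  burn : ∀ {p} m (ρ : Fin m → ℕ) → StrictlyIncreasing ρ → ∀ σ (f : Forest p) →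
         size f ≤ total ρ + gain m + (σ + σ) →
         ∃₂ λ (x : Fin m → Fin n) y →
           ∀ {w} → w ∈ᵗ f → (∃[ i ] Within (ρ i) (x i) w) ⊎ Within σ y w
  burn zero ρ ρ↑ σ f small with covers-small f small
  ... | y , cov = (λ ()) , y , inj₂ ∘ cov
  burn {p} (suc m) ρ ρ↑ σ f small with height f ≤? ρ (fromℕ m)
  ... | yes low = (λ _ → p) , p , λ w∈f → inj₁ (fromℕ m , covers-height f low w∈f)
  ... | no tall with find-saving m ρ ρ↑ ⌊ suc m /3⌋ (3*⌊m/3⌋≤m (suc m)) f (≰⇒> tall)
  ...   | saving i {subtree = t} {rest} cut gains c cov
    with burn m (removeAt ρ i) (removeAt-increasing i ρ↑) σ rest rest-small
    where
    open ≤-Reasoning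
    g = ⌊ suc m /3⌋
    s = total (removeAt ρ i)
    regroup : ∀ a s g h z → suc a + s + (g + h) + z ≡ s + h + z + suc (a + g)
    regroup = solve-∀
    rest-small : size rest ≤ s + gain m + (σ + σ)
    rest-small = +-cancelʳ-≤ (suc (ρ i + g)) _ _ (begin
      size rest + suc (ρ i + g)                    ≤⟨ +-monoʳ-≤ (size rest) (s≤s gains) ⟩
      size rest + suc (size t)                     ≡⟨ sym (cut-size cut) ⟩
      size f                                       ≤⟨ small ⟩
      total ρ + (g + gain m) + (σ + σ)       ≡⟨ cong (λ z → z + (g + gain m) + (σ + σ)) (total-remove ρ i) ⟩
      suc (ρ i) + s + (g + gain m) + (σ + σ)       ≡⟨ regroup (ρ i) s g (gain m) (σ + σ) ⟩
      s + gain m + (σ + σ) + suc (ρ i + g)         ∎)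
  ...     | x , y , burnt = insertAt x i c , y , λ w∈f → [ inRest , inSubtree ]′ (cut-∈ᵗ cut w∈f)
    where
    inRest : ∀ {w} → w ∈ᵗ rest → (∃[ k ] Within (ρ k) (insertAt x i c k) w) ⊎ Within σ y w
    inRest w∈rest with burnt w∈rest
    ... | inj₁ (k , near) = inj₁ (punchIn i k , subst (λ u → Within _ u _) (sym (insertAt-punchIn x i c k)) near)
    ... | inj₂ near       = inj₂ near
    inSubtree : ∀ {w} → w ∈ᵗ t → (∃[ k ] Within (ρ k) (insertAt x i c k) w) ⊎ Within σ y w
    inSubtree w∈t = inj₁ (i , subst (λ u → Within _ u _) (sym (insertAt-lookup x i c)) (cov w∈t))

  record Grafted {p} (f : Forest p) (v : Fin n) : Set where
    constructor grafted
    field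
      forest : Forest p
      size≡  : size forest ≡ suc (size f)
      new    : v ∈ᶠ forest
      old    : ∀ {w} → w ∈ᶠ f → w ∈ᶠ forest

  graft : ∀ {p u v} (f : Forest p) → u ∈ᵗ f → Adj u v → Grafted f v
  graft f (inj₁ refl) e = grafted (node _ e [] f) refl here later
  graft (node u e′ c s) (inj₂ here) e with graft c (inj₁ refl) e
  ... | grafted c′ eq new old = grafted (node u e′ c′ s) (cong (λ z → suc (z + size s)) eq) (child new)
        λ { here → here ; (child w∈c) → child (old w∈c) ; (later w∈s) → later w∈s }
  graft (node u e′ c s) (inj₂ (child u∈c)) e with graft c (inj₂ u∈c) e
  ... | grafted c′ eq new old = grafted (node u e′ c′ s) (cong (λ z → suc (z + size s)) eq) (child new)
        λ { here → here ; (child w∈c) → child (old w∈c) ; (later w∈s) → later w∈s }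
  graft (node u e′ c s) (inj₂ (later u∈s)) e with graft s (inj₂ u∈s) e
  ... | grafted s′ eq new old = grafted (node u e′ c s′) (cong suc (trans (cong (size c +_) eq) (+-suc (size c) (size s)))) (later new)
        λ { here → here ; (child w∈c) → child w∈c ; (later w∈s) → later (old w∈s) }

  -- xs may repeat vertices of f: it only has to contain all the missing ones.
  crossing : ∀ {p} (f : Forest p) (xs : List (Fin n)) → (∀ w → w ∈ᵗ f ⊎ w ∈ xs) →
             ∀ {u v} → Walk G u v → u ∈ᵗ f →
             v ∈ᵗ f ⊎ ∃₂ λ u′ v′ → u′ ∈ᵗ f × Adj u′ v′ × v′ ∈ xs
  crossing f xs all nil u∈f = inj₁ u∈f
  crossing f xs all (cons {v = v} e p) u∈f with all v
  ... | inj₁ v∈f  = crossing f xs all p v∈f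
  ... | inj₂ v∈xs = inj₂ (_ , v , u∈f , e , v∈xs)

  spanning : Connected G → ∀ {p} m (f : Forest p) (xs : List (Fin n)) → lengthᴸ xs ≡ m →
             (∀ w → w ∈ᵗ f ⊎ w ∈ xs) →
             ∃[ f′ ] size {p} f′ ≤ size f + m × (∀ w → w ∈ᵗ f′)
  spanning conn zero f [] refl all =
    f , m≤m+n (size f) 0 , λ w → [ id , (λ ()) ]′ (all w)
  spanning conn {p} (suc m) f (x ∷ xs) len all with crossing f (x ∷ xs) all (conn p x) (inj₁ refl)
  ... | inj₁ x∈f with spanning conn m f xs (suc-injective len) all′
    where
    all′ : ∀ w → w ∈ᵗ f ⊎ w ∈ xs
    all′ w with all w
    ... | inj₁ w∈f          = inj₁ w∈f
    ... | inj₂ (here refl)  = inj₁ x∈f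
    ... | inj₂ (there w∈xs) = inj₂ w∈xs
  ...   | f′ , small , spans = f′ , ≤-trans small (+-monoʳ-≤ (size f) (n≤1+n m)) , spans
  spanning conn {p} (suc m) f (x ∷ xs) len all | inj₂ (u , v , u∈f , e , v∈xs) with graft f u∈f e
  ... | grafted f₁ eq new old
    with spanning conn m f₁ (x ∷ xs ─ v∈xs) (suc-injective (trans (sym (length-removeAt′ (x ∷ xs) (index v∈xs))) len)) all′
    where
    all′ : ∀ w → w ∈ᵗ f₁ ⊎ w ∈ (x ∷ xs ─ v∈xs)
    all′ w with all w
    ... | inj₁ (inj₁ w≡p) = inj₁ (inj₁ w≡p)
    ... | inj₁ (inj₂ w∈f) = inj₁ (inj₂ (old w∈f))
    ... | inj₂ w∈xs with ∈-─ v∈xs w∈xs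
    ...   | inj₁ refl = inj₁ (inj₂ new)
    ...   | inj₂ w∈   = inj₂ w∈
  ...   | f′ , small , spans =
    f′ , ≤-trans small (≤-reflexive (trans (cong (_+ m) eq) (sym (+-suc (size f) m)))) , spans

  spanning-tree : Connected G → ∀ r → ∃[ f ] size {r} f < n × (∀ w → w ∈ᵗ f)
  spanning-tree conn r with spanning conn _ [] (allFin n ─ ∈-allFin r) refl all
    where
    all : ∀ w → w ∈ᵗ [] {r} ⊎ w ∈ (allFin n ─ ∈-allFin r)
    all w = [ inj₁ ∘ inj₁ , inj₂ ]′ (∈-─ (∈-allFin r) (∈-allFin w))
  ... | f , small , spans = f , ≤-trans (s≤s small) (≤-reflexive n≡) , spans
    where
    n≡ : suc (lengthᴸ (allFin n ─ ∈-allFin r)) ≡ n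
    n≡ = trans (sym (length-removeAt′ (allFin n) (index (∈-allFin r)))) (length-tabulate id)

theorem3 : (j : ℕ) (a : Fin (suc j) → ℕ) →
    (∀ i → 0 < a i) →
    (∀ {i i′} → i <ᶠ i′ → a i < a i′) →
    ∀ {n} (T : Graph n) → IsTree T →
    n ≤ orderBound j a →
    Burnable T a
theorem3 j a a>0 a↑ {n} T tree n≤ with spanning-tree T (IsTree.connected tree) (fromℕ< (>-nonZero⁻¹ n {{IsTree.nonempty tree}}))
... | f , f<n , spans with burn T j ρ (removeAt-increasing top radius↑) σ f small
  where
  open ≤-Reasoning
  top = fromℕ j
  radius : Fin (suc j) → ℕ
  radius i = a i ∸ 1
  suc-radius : ∀ i → a i ≡ suc (radius i)
  suc-radius i = sym (suc-pred (a i) {{>-nonZero (a>0 i)}})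
  radius↑ : StrictlyIncreasing radius
  radius↑ {i} {i′} i<i′ = s≤s⁻¹ (subst₂ _<_ (suc-radius i) (suc-radius i′) (a↑ i<i′))
  ρ = removeAt radius top
  σ = radius top
  sum-a : sum a ≡ suc σ + total ρ
  sum-a = trans (sum-cong-≗ suc-radius) (total-remove radius top)
  bonus = (suc j * suc j + 2 ∸ 3 * suc j) / 6
  regroup : ∀ s x b → x + s + suc x + b ≡ suc (s + b + (x + x))
  regroup = solve-∀
  small : size T f ≤ total ρ + gain j + (σ + σ)
  small = s≤s⁻¹ (begin
    suc (size T f)                             ≤⟨ f<n ⟩
    n                                          ≤⟨ n≤ ⟩
    (sum a + a top ∸ 1) + bonus                ≤⟨ +-monoʳ-≤ _ (bonus≤gain j) ⟩
    (sum a + a top ∸ 1) + gain j               ≡⟨ cong (λ x → (x ∸ 1) + gain j) (trans (cong (_+ a top) sum-a) (cong (suc σ + total ρ +_) (suc-radius top))) ⟩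
    σ + total ρ + suc σ + gain j         ≡⟨ regroup (total ρ) σ (gain j) ⟩
    suc (total ρ + gain j + (σ + σ))     ∎)
... | x , y , burnt = insertAt x (fromℕ j) y , λ w → ball (burnt (spans w))
  where
  top = fromℕ j
  ball : ∀ {w} → (∃[ i ] Within T (a (punchIn top i) ∸ 1) (x i) w) ⊎ Within T (a top ∸ 1) y w →
         ∃[ i ] InBall T (a i ∸ 1) (insertAt x top y i) w
  ball {w} (inj₁ (i , near)) = punchIn top i ,
    within⇒InBall T (subst (λ u → Within T (a (punchIn top i) ∸ 1) u w) (sym (insertAt-punchIn x top y i)) near)
  ball {w} (inj₂ near) = top ,
    within⇒InBall T (subst (λ u → Within T (a top ∸ 1) u w) (sym (insertAt-lookup x top y)) near)
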